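{- Let $\Sigma(d,n)$ denote the maximum dual diameter among pure $(d-1)$-dimensional normal simplicial complexes on $n$ vertices which are pseudomanifolds without boundary. If $n > d \geq 4$, then $\Sigma(d,n) \leq (n-d)^{\log d}$.
   Context: A simplicial complex is pure of dimension $d-1$ if all its maximal faces (facets) have dimension $d-1$. It is normal if it is connected and the link of every face of dimension at most $d-3$ is connected (equivalently, every face's star has a connected dual graph). It is a pseudomanifold without boundary if every $(d-2)$-dimensional face is contained in exactly two facets. The dual graph has the facets as vertices, two facets being adjacent if they share a $(d-2)$-dimensional face; the dual diameter is the diameter of this graph. Here $n$ is the number of vertices of the complex. All logarithms are base $2$. -}

module Defs where

open import Data.Nat using (ℕ; zero; suc; _+_; _*_; _∸_; _^_; _≤_; _<_)
open import Data.Fin using (Fin)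
open import Data.Fin.Subset using (Subset; _∈_; _∉_; _⊆_; _∩_; _∪_; ⁅_⁆; ∣_∣)
open import Data.List using (List)
open import Data.List.Relation.Unary.Unique.Propositional using (Unique)
import Data.List.Membership.Propositional as L
open import Data.Product using (Σ; ∃; ∃-syntax; _×_)
open import Data.Sum using (_⊎_)
open import Relation.Nullary using (¬_)
open import Relation.Binary.PropositionalEquality using (_≡_; _≢_)
open import Relation.Binary.Construct.Closure.ReflexiveTransitive using (Star)

-- A pure (d-1)-dimensional simplicial complex on the vertex set Fin n,
-- given by its list of facets (each facet a d-element subset of Fin n).
-- Facets are pairwise distinct; since they all have the same size, none
-- contains another, so they are exactly the maximal faces.
-- "On n vertices": every vertex of Fin n lies in some facet.
record PureComplex (d n : ℕ) : Set where
  field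
    facets       : List (Subset n)
    facets-size  : ∀ {F} → F L.∈ facets → ∣ F ∣ ≡ d
    facets-dist  : Unique facets
    all-vertices : ∀ (v : Fin n) → ∃[ F ] (F L.∈ facets × v ∈ F)

module _ {d n : ℕ} (K : PureComplex d n) where
  open PureComplex K

  IsFace : Subset n → Set
  IsFace σ = ∃[ F ] (F L.∈ facets × σ ⊆ F)

  -- 1-skeleton edge relation of K (u ≡ v allowed, giving reflexivity)
  Edge : Fin n → Fin n → Set
  Edge u v = IsFace (⁅ u ⁆ ∪ ⁅ v ⁆)

  Connected : Set
  Connected = ∀ (u v : Fin n) → Star Edge u v

  -- the link lk(σ) = { τ : τ ∩ σ = ∅, τ ∪ σ ∈ K }; its vertices and edges
  LinkVertex : Subset n → Fin n → Set
  LinkVertex σ v = v ∉ σ × IsFace (σ ∪ ⁅ v ⁆)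

  LinkEdge : Subset n → Fin n → Fin n → Set
  LinkEdge σ u v = u ∉ σ × v ∉ σ × IsFace (σ ∪ (⁅ u ⁆ ∪ ⁅ v ⁆))

  LinkConnected : Subset n → Set
  LinkConnected σ = ∀ u v → LinkVertex σ u → LinkVertex σ v → Star (LinkEdge σ) u v

  -- normal: connected, and the link of every face of dimension ≤ d-3
  -- (i.e. with at most d-2 vertices) is connected
  Normal : Set
  Normal = Connected × (∀ σ → IsFace σ → ∣ σ ∣ ≤ d ∸ 2 → LinkConnected σ)

  PseudomanifoldWithoutBoundary : Set
  PseudomanifoldWithoutBoundary =
    ∀ τ → IsFace τ → ∣ τ ∣ ≡ d ∸ 1 →
      ∃[ F ] ∃[ G ] (F L.∈ facets × G L.∈ facets × F ≢ G × τ ⊆ F × τ ⊆ G ×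
        (∀ H → H L.∈ facets → τ ⊆ H → H ≡ F ⊎ H ≡ G))

  -- dual graph: facets adjacent iff they share a (d-2)-face, i.e. |F ∩ G| = d-1
  DualAdj : Subset n → Subset n → Set
  DualAdj F G = F L.∈ facets × G L.∈ facets × ∣ F ∩ G ∣ ≡ d ∸ 1

  data DualWalk : ℕ → Subset n → Subset n → Set where
    done : ∀ {F} → F L.∈ facets → DualWalk zero F F
    step : ∀ {k F G H} → DualAdj F G → DualWalk k G H → DualWalk (suc k) F H

-- For natural numbers D and x, D ≤ x ^ (log₂ d) (a real exponent) is encoded
-- as: for all p, q ≥ 1 with p/q > log₂ d (i.e. d^q < 2^p), D^q ≤ x^p.
-- (For x ≥ 1 this is equivalent, by continuity of r ↦ x^r from the right.)
LePowLog₂ : ℕ → ℕ → ℕ → Set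
LePowLog₂ D x d = ∀ (p q : ℕ) → 1 ≤ q → d ^ q < 2 ^ p → D ^ q ≤ x ^ p

DualDiamLePowLog : ∀ {d n} → PureComplex d n → ℕ → ℕ → Set
DualDiamLePowLog {n = n} K x d =
  ∀ (F G : Subset n) → F L.∈ PureComplex.facets K → G L.∈ PureComplex.facets K →
    ∃[ D ] (DualWalk K D F G × LePowLog₂ D x d)

{-# OPTIONS --safe #-}
-- Fix a facet G and let ℓ be the dual distance to G. Normality makes the star of every
-- face σ dually connected, so the facets of the star meet every value of ℓ between any
-- two attained ones. If f(k, w) bounds the length of an interval of layers in the star
-- of a face of codimension k whose facets use at most w vertices outside the face, then
-- Kalai and Kleitman's argument gives
--   f(k, w) ≤ f(k - 1, w - 1) + 2 f(k, ⌊w/2⌋) + 2,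
-- where the last two terms occur only if k ≤ ⌊w/2⌋. Starting from f(2, w) ≤ w - 2 this
-- yields f(3, w)² ≤ (w - 3)³, hence f(3, w) ≤ (w - 3)^(log 3), and then, by Todd's
-- estimate, f(k, w) ≤ (w - k)^(log k) for all k ≥ 3. Real exponents are compared through
-- natural p, q with p / q > log k, and sums are handled by mediants.
module Submission where

open import Defs
open import Data.Nat hiding (∣_-_∣)
open import Data.Nat.Properties
open import Data.Nat.Induction using (<-rec)
open import Data.Nat.Tactic.RingSolver using (solve-∀)
import Data.Bool.Properties as Bool
open import Data.Fin using (Fin)
open import Data.Fin.Subset using (Subset; _∈_; _∉_; _⊆_; _∩_; _∪_; _─_; _-_; ⁅_⁆; ∣_∣; ⊥; inside; outside)
open import Data.Fin.Subset.Properties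
import Data.List.Membership.Propositional as L
import Data.List.Membership.DecPropositional as DecMembership
open import Data.List.Relation.Unary.Any using (any?)
open import Data.Vec using ([]; _∷_; tabulate; there)
open import Data.Vec.Properties using (≡-dec; lookup∘tabulate; lookup⇒[]=; []=⇒lookup)
open import Data.Product using (_×_; _,_; ∃-syntax; proj₁; proj₂)
open import Data.Sum using (_⊎_; inj₁; inj₂; [_,_]′)
open import Function using (_∘_)
open import Relation.Nullary using (¬_; Dec; yes; no; does; contradiction; ¬?)
open import Relation.Nullary.Decidable using (map′; _×-dec_; dec-true; decidable-stable)
open import Relation.Unary using (Decidable)
open import Relation.Binary.PropositionalEquality
open import Relation.Binary.Construct.Closure.ReflexiveTransitive as Star using (Star; ε; _◅_; _◅◅_)

-- Powers and logarithmic exponents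

least : ∀ {P : ℕ → Set} → Decidable P → ∀ N → P N → ∃[ t ] (P t × (∀ s → P s → t ≤ s))
least P? zero p = zero , p , λ _ _ → z≤n
least {P} P? (suc N) p with P? zero
... | yes p₀ = zero , p₀ , λ _ _ → z≤n
... | no ¬p₀ with least (λ t → P? (suc t)) N p
...   | t , pt , min = suc t , pt , bound
  where
  bound : ∀ s → P s → suc t ≤ s
  bound zero    p₀ = contradiction p₀ ¬p₀
  bound (suc s) ps = s≤s (min s ps)

^-distribʳ-* : ∀ q a b → (a * b) ^ q ≡ a ^ q * b ^ q
^-distribʳ-* zero    a b = refl
^-distribʳ-* (suc q) a b = trans (cong (a * b *_) (^-distribʳ-* q a b)) ([m*n]*[o*p]≡[m*o]*[n*p] a b (a ^ q) (b ^ q))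

^-comm : ∀ a m n → (a ^ m) ^ n ≡ (a ^ n) ^ m
^-comm a m n = begin
  (a ^ m) ^ n ≡⟨ ^-*-assoc a m n ⟩
  a ^ (m * n) ≡⟨ cong (a ^_) (*-comm m n) ⟩
  a ^ (n * m) ≡⟨ ^-*-assoc a n m ⟨
  (a ^ n) ^ m ∎
  where open ≡-Reasoning

^-cancelˡ-≤ : ∀ q .{{_ : NonZero q}} {a b} → a ^ q ≤ b ^ q → a ≤ b
^-cancelˡ-≤ q {a} {b} a^q≤b^q with a ≤? b
... | yes a≤b = a≤b
... | no  a≰b = contradiction (^-monoˡ-< q (≰⇒> a≰b)) (≤⇒≯ a^q≤b^q)

-- Bernoulli's inequality 1 + N / b ≤ (1 + 1 / b)^N, multiplied by b · b^N to avoid division.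
bernoulli : ∀ b N → (b + N) * b ^ N ≤ b * suc b ^ N
bernoulli b zero    = ≤-reflexive (cong (_* 1) (+-identityʳ b))
bernoulli b (suc N) = begin
  (b + suc N) * (b * b ^ N)           ≡⟨ lhs b N (b ^ N) ⟩
  (b * b + N * b + b) * b ^ N         ≤⟨ *-monoˡ-≤ (b ^ N) (m≤m+n (b * b + N * b + b) N) ⟩
  (b * b + N * b + b + N) * b ^ N     ≡⟨ mid b N (b ^ N) ⟩
  suc b * ((b + N) * b ^ N)           ≤⟨ *-monoʳ-≤ (suc b) (bernoulli b N) ⟩
  suc b * (b * suc b ^ N)             ≡⟨ rhs b (suc b ^ N) ⟩
  b * (suc b * suc b ^ N)             ∎
  where
  open ≤-Reasoning
  lhs : ∀ b N X → (b + suc N) * (b * X) ≡ (b * b + N * b + b) * X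
  lhs = solve-∀
  mid : ∀ b N X → (b * b + N * b + b + N) * X ≡ suc b * ((b + N) * X)
  mid = solve-∀
  rhs : ∀ b X → suc b * (b * X) ≡ b * (suc b * X)
  rhs = solve-∀

-- If a ≥ b + 1 and b > 0, then (a / b)^N grows at least linearly by `bernoulli` and overtakes any
-- constant c. This removes the constant left by rounding in `LePowLog₂-base`.
powers-≤⇒≤ : ∀ a b c → (∀ N → 1 ≤ N → a ^ N ≤ c * b ^ N) → a ≤ b
powers-≤⇒≤ a zero c h = begin
  a              ≡⟨ *-identityʳ a ⟨
  a ^ 1          ≤⟨ h 1 ≤-refl ⟩
  c * 0          ≡⟨ *-zeroʳ c ⟩
  0              ∎
  where open ≤-Reasoning
powers-≤⇒≤ a b@(suc _) c h with a ≤? b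
... | yes a≤b = a≤b
... | no  a≰b = contradiction b+N≤bc (<⇒≱ bc<b+N)
  where
  -- Chosen so that b + N exceeds b c.
  N = suc (b * c)
  open ≤-Reasoning
  instance _ = m^n≢0 b N
  b+N≤bc : b + N ≤ b * c
  b+N≤bc = *-cancelʳ-≤ (b + N) (b * c) (b ^ N) (begin
    (b + N) * b ^ N   ≤⟨ bernoulli b N ⟩
    b * suc b ^ N     ≤⟨ *-monoʳ-≤ b (^-monoˡ-≤ N (≰⇒> a≰b)) ⟩
    b * a ^ N         ≤⟨ *-monoʳ-≤ b (h N (s≤s z≤n)) ⟩
    b * (c * b ^ N)   ≡⟨ *-assoc b c (b ^ N) ⟨
    b * c * b ^ N     ∎)
  bc<b+N : b * c < b + N
  bc<b+N = m≤n+m N b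

n<2^n : ∀ n → n < 2 ^ n
n<2^n zero    = s≤s z≤n
n<2^n (suc n) = begin-strict
  suc n               ≤⟨ n<2^n n ⟩
  2 ^ n               <⟨ m<m+n (2 ^ n) (≤-trans (m^n>0 2 n) (≤-reflexive (sym (+-identityʳ (2 ^ n))))) ⟩
  2 ^ n + (2 ^ n + 0) ∎
  where open ≤-Reasoning

-- The real inequality a ≤ α · X^(1/q).
infix 4 _≤[_,_]_
record _≤[_,_]_ (a q X α : ℕ) : Set where
  constructor mk≤[]
  field powers-≤ : a ^ q ≤ α ^ q * X

module _ {q X : ℕ} where
  open ≤-Reasoning

  1^q*X≡X : 1 ^ q * X ≡ X
  1^q*X≡X = trans (cong (_* X) (^-zeroˡ q)) (*-identityˡ X)

  ≤[]1⁺ : ∀ {a} → a ^ q ≤ X → a ≤[ q , X ] 1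
  ≤[]1⁺ a^q≤X = mk≤[] (≤-trans a^q≤X (≤-reflexive (sym 1^q*X≡X)))

  ≤[]1⁻ : ∀ {a} → a ≤[ q , X ] 1 → a ^ q ≤ X
  ≤[]1⁻ (mk≤[] a≤1) = ≤-trans a≤1 (≤-reflexive 1^q*X≡X)

  ≤[]-scale : ∀ c {a α} → a ≤[ q , X ] α → c * a ≤[ q , X ] c * α
  ≤[]-scale c {a} {α} (mk≤[] a≤α) = mk≤[] (begin
    (c * a) ^ q         ≡⟨ ^-distribʳ-* q c a ⟩
    c ^ q * a ^ q       ≤⟨ *-monoʳ-≤ (c ^ q) a≤α ⟩
    c ^ q * (α ^ q * X) ≡⟨ *-assoc (c ^ q) (α ^ q) X ⟨
    c ^ q * α ^ q * X   ≡⟨ cong (_* X) (^-distribʳ-* q c α) ⟨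
    (c * α) ^ q * X     ∎)

  ≤[]-unscale : ∀ c .{{_ : NonZero c}} {a α} → c * a ≤[ q , X ] c * α → a ≤[ q , X ] α
  ≤[]-unscale c {a} {α} (mk≤[] ca≤cα) = mk≤[] (*-cancelˡ-≤ (c ^ q) {{m^n≢0 c q}} (begin
    c ^ q * a ^ q       ≡⟨ ^-distribʳ-* q c a ⟨
    (c * a) ^ q         ≤⟨ ca≤cα ⟩
    (c * α) ^ q * X     ≡⟨ cong (_* X) (^-distribʳ-* q c α) ⟩
    c ^ q * α ^ q * X   ≡⟨ *-assoc (c ^ q) (α ^ q) X ⟩
    c ^ q * (α ^ q * X) ∎))

  ≤[]-mono : ∀ {a a′ α α′} → a′ ≤ a → α ≤ α′ → a ≤[ q , X ] α → a′ ≤[ q , X ] α′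
  ≤[]-mono a′≤a α≤α′ (mk≤[] a≤α) = mk≤[]
    (≤-trans (^-monoˡ-≤ q a′≤a) (≤-trans a≤α (*-monoˡ-≤ X (^-monoˡ-≤ q α≤α′))))

  -- The larger of the two ratios a / α and b / β bounds their mediant.
  ≤[]-+ : ∀ {a b} α β .{{_ : NonZero α}} .{{_ : NonZero β}} →
          a ≤[ q , X ] α → b ≤[ q , X ] β → a + b ≤[ q , X ] α + β
  ≤[]-+ {a} {b} α β a≤α b≤β with ≤-total (β * a) (α * b)
  ... | inj₁ βa≤αb = ≤[]-unscale β (≤[]-mono
          (begin
            β * (a + b)     ≡⟨ *-distribˡ-+ β a b ⟩
            β * a + β * b   ≤⟨ +-monoˡ-≤ (β * b) βa≤αb ⟩
            α * b + β * b   ≡⟨ *-distribʳ-+ b α β ⟨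
            (α + β) * b     ∎)
          (≤-reflexive (*-comm (α + β) β))
          (≤[]-scale (α + β) b≤β))
  ... | inj₂ αb≤βa = ≤[]-unscale α (≤[]-mono
          (begin
            α * (a + b)     ≡⟨ *-distribˡ-+ α a b ⟩
            α * a + α * b   ≤⟨ +-monoʳ-≤ (α * a) αb≤βa ⟩
            α * a + β * a   ≡⟨ *-distribʳ-+ a α β ⟨
            (α + β) * a     ∎)
          (≤-reflexive (*-comm (α + β) α))
          (≤[]-scale (α + β) a≤α))

LePowLog₂-mono-≤ : ∀ {D D′ x d d′} → D′ ≤ D → d ≤ d′ → LePowLog₂ D x d → LePowLog₂ D′ x d′
LePowLog₂-mono-≤ D′≤D d≤d′ D≤ p q 1≤q d′^q<2^p =
  ≤-trans (^-monoˡ-≤ q D′≤D) (D≤ p q 1≤q (≤-<-trans (^-monoˡ-≤ q d≤d′) d′^q<2^p))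

LePowLog₂-zero : ∀ x d → LePowLog₂ 0 x d
LePowLog₂-zero x d p (suc q) 1≤q _ = z≤n

-- B ≤ y^(log d) gives d B ≤ (2 y)^(log d).
LePowLog₂-double : ∀ {B y x d} → LePowLog₂ B y d → 2 * y ≤ x →
                   ∀ p q → 1 ≤ q → d ^ q < 2 ^ p → d * B ≤[ q , x ^ p ] 1
LePowLog₂-double {B} {y} {x} {d} B≤ 2y≤x p q 1≤q d^q<2^p = ≤[]1⁺ (begin
  (d * B) ^ q       ≡⟨ ^-distribʳ-* q d B ⟩
  d ^ q * B ^ q     ≤⟨ *-mono-≤ (<⇒≤ d^q<2^p) (B≤ p q 1≤q d^q<2^p) ⟩
  2 ^ p * y ^ p     ≡⟨ ^-distribʳ-* p 2 y ⟨
  (2 * y) ^ p       ≤⟨ ^-monoˡ-≤ p 2y≤x ⟩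
  x ^ p             ∎)
  where open ≤-Reasoning

-- d^j = (2^j)^(log d), and 2^j ≤ x.
d^j≤x^log-d : ∀ {x} d j → 2 ^ j ≤ x → ∀ p q → d ^ q < 2 ^ p → d ^ j ≤[ q , x ^ p ] 1
d^j≤x^log-d {x} d j 2^j≤x p q d^q<2^p = ≤[]1⁺ (begin
  (d ^ j) ^ q       ≡⟨ ^-comm d j q ⟩
  (d ^ q) ^ j       ≤⟨ ^-monoˡ-≤ j (<⇒≤ d^q<2^p) ⟩
  (2 ^ p) ^ j       ≡⟨ ^-comm 2 p j ⟩
  (2 ^ j) ^ p       ≤⟨ ^-monoˡ-≤ p 2^j≤x ⟩
  x ^ p             ∎)
  where open ≤-Reasoning

-- For x ≥ 2^j one has x^(log e) ≤ (e / d)^j x^(log d). The exponent log e is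
-- approximated by p′ / (q N) with an error of one factor 2^j, which disappears as N grows.
LePowLog₂-base : ∀ {A x e d} j .{{_ : NonZero e}} → e ≤ d → LePowLog₂ A x e → 2 ^ j ≤ x →
                 ∀ p q → 1 ≤ q → d ^ q < 2 ^ p → d ^ j * A ≤[ q , x ^ p ] e ^ j
LePowLog₂-base {A} {x} {e} {d} j e≤d A≤ 2^j≤x p q 1≤q d^q<2^p =
  mk≤[] (powers-≤⇒≤ _ _ (2 ^ j) bound)
  where
  open ≤-Reasoning
  e^qN<2^pN : ∀ N .{{_ : NonZero N}} → e ^ (q * N) < 2 ^ (p * N)
  e^qN<2^pN N = begin-strict
    e ^ (q * N)   ≡⟨ ^-*-assoc e q N ⟨
    (e ^ q) ^ N   <⟨ ^-monoˡ-< N (≤-<-trans (^-monoˡ-≤ q e≤d) d^q<2^p) ⟩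
    (2 ^ p) ^ N   ≡⟨ ^-*-assoc 2 p N ⟩
    2 ^ (p * N)   ∎
  bound : ∀ N → 1 ≤ N → ((d ^ j * A) ^ q) ^ N ≤ 2 ^ j * ((e ^ j) ^ q * x ^ p) ^ N
  -- The candidate p N guarantees p′ ≤ p N; minimality of p′ gives 2^(p′ - 1) ≤ e^(q N), so p′ / (q
  -- N) exceeds log e by at most 1 / (q N).
  bound N@(suc _) 1≤N with least (λ t → e ^ (q * N) <? 2 ^ t) (p * N) (e^qN<2^pN N)
  ... | zero , e^Q<1 , _ = contradiction (m^n>0 e (q * N)) (<⇒≱ e^Q<1)
  ... | p′@(suc p″) , e^Q<2^p′ , p′-min = begin
      ((d ^ j * A) ^ q) ^ N                       ≡⟨ ^-*-assoc (d ^ j * A) q N ⟩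
      (d ^ j * A) ^ Q                             ≡⟨ ^-distribʳ-* Q (d ^ j) A ⟩
      (d ^ j) ^ Q * A ^ Q                         ≤⟨ *-mono-≤ d^jQ≤ A^Q≤ ⟩
      2 ^ j * (e ^ j) ^ Q * x ^ r * x ^ p′        ≡⟨ *-assoc (2 ^ j * (e ^ j) ^ Q) (x ^ r) (x ^ p′) ⟩
      2 ^ j * (e ^ j) ^ Q * (x ^ r * x ^ p′)      ≡⟨ cong (2 ^ j * (e ^ j) ^ Q *_) (^-distribˡ-+-* x r p′) ⟨
      2 ^ j * (e ^ j) ^ Q * x ^ (r + p′)          ≡⟨ cong (λ t → 2 ^ j * (e ^ j) ^ Q * x ^ t) r+p′≡ ⟩
      2 ^ j * (e ^ j) ^ Q * x ^ (p * N)           ≡⟨ *-assoc (2 ^ j) ((e ^ j) ^ Q) (x ^ (p * N)) ⟩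
      2 ^ j * ((e ^ j) ^ Q * x ^ (p * N))         ≡⟨ cong (2 ^ j *_) (cong₂ _*_ (sym (^-*-assoc (e ^ j) q N)) (sym (^-*-assoc x p N))) ⟩
      2 ^ j * (((e ^ j) ^ q) ^ N * (x ^ p) ^ N)   ≡⟨ cong (2 ^ j *_) (^-distribʳ-* N ((e ^ j) ^ q) (x ^ p)) ⟨
      2 ^ j * ((e ^ j) ^ q * x ^ p) ^ N           ∎
    where
    Q = q * N
    r = p * N ∸ p′
    r+p′≡ : r + p′ ≡ p * N
    r+p′≡ = m∸n+n≡m (p′-min (p * N) (e^qN<2^pN N))
    2^p″≤e^Q : 2 ^ p″ ≤ e ^ Q
    2^p″≤e^Q = ≮⇒≥ λ e^Q<2^p″ → 1+n≰n (p′-min p″ e^Q<2^p″)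
    A^Q≤ : A ^ Q ≤ x ^ p′
    A^Q≤ = A≤ p′ Q (*-mono-≤ 1≤q 1≤N) e^Q<2^p′
    -- Split 2^(p N) as 2^p′ · 2^r. The first factor is at most 2 e^Q, and the j-th power of the
    -- second is at most x^r since 2^j ≤ x.
    d^jQ≤ : (d ^ j) ^ Q ≤ 2 ^ j * (e ^ j) ^ Q * x ^ r
    d^jQ≤ = begin
      (d ^ j) ^ Q                         ≡⟨ ^-comm d j Q ⟩
      (d ^ Q) ^ j                         ≡⟨ cong (_^ j) (^-*-assoc d q N) ⟨
      ((d ^ q) ^ N) ^ j                   ≤⟨ ^-monoˡ-≤ j (^-monoˡ-≤ N (<⇒≤ d^q<2^p)) ⟩
      ((2 ^ p) ^ N) ^ j                   ≡⟨ cong (_^ j) (^-*-assoc 2 p N) ⟩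
      (2 ^ (p * N)) ^ j                   ≡⟨ cong (λ t → (2 ^ t) ^ j) (trans (sym r+p′≡) (+-comm r p′)) ⟩
      (2 ^ (p′ + r)) ^ j                  ≡⟨ cong (_^ j) (^-distribˡ-+-* 2 p′ r) ⟩
      (2 ^ p′ * 2 ^ r) ^ j                ≡⟨ ^-distribʳ-* j (2 ^ p′) (2 ^ r) ⟩
      (2 * 2 ^ p″) ^ j * (2 ^ r) ^ j      ≡⟨ cong (_* (2 ^ r) ^ j) (^-distribʳ-* j 2 (2 ^ p″)) ⟩
      2 ^ j * (2 ^ p″) ^ j * (2 ^ r) ^ j  ≤⟨ *-mono-≤ (*-monoʳ-≤ (2 ^ j) (^-monoˡ-≤ j 2^p″≤e^Q)) (≤-trans (≤-reflexive (^-comm 2 r j)) (^-monoˡ-≤ r 2^j≤x)) ⟩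
      2 ^ j * (e ^ Q) ^ j * x ^ r         ≡⟨ cong (λ t → 2 ^ j * t * x ^ r) (^-comm e Q j) ⟩
      2 ^ j * (e ^ j) ^ Q * x ^ r         ∎

-- The case x ≥ 8: relative to x^(log d), the three summands are at most
-- e³ / d³, 2 / d and 2 / d³, where e = d - 1.
LePowLog₂-step-large : ∀ {A B D x y} e → 3 ≤ e → 8 ≤ x → 2 * y ≤ x →
  LePowLog₂ A x e → LePowLog₂ B y (suc e) → D ≤ A + 2 * B + 2 → LePowLog₂ D x (suc e)
LePowLog₂-step-large {A} {B} {D} {x} {y} e@(suc (suc (suc f))) (s≤s (s≤s (s≤s _))) 8≤x 2y≤x A≤ B≤ D≤ p q 1≤q d^q<2^p
  = ≤[]1⁻ D≤[]1
  where
  d = suc e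
  X = x ^ p
  instance
    _ = m^n≢0 e 3
    _ = m^n≢0 d 3
  a : d ^ 3 * A ≤[ q , X ] e ^ 3
  a = LePowLog₂-base 3 (n≤1+n e) A≤ 8≤x p q 1≤q d^q<2^p
  b : 2 * d ^ 2 * (d * B) ≤[ q , X ] 2 * d ^ 2 * 1
  b = ≤[]-scale (2 * d ^ 2) (LePowLog₂-double B≤ 2y≤x p q 1≤q d^q<2^p)
  c : 2 * d ^ 3 ≤[ q , X ] 2 * 1
  c = ≤[]-scale 2 (d^j≤x^log-d d 3 8≤x p q d^q<2^p)
  total : d ^ 3 * A + 2 * d ^ 2 * (d * B) + 2 * d ^ 3 ≤[ q , X ] e ^ 3 + 2 * d ^ 2 * 1 + 2 * 1
  total = ≤[]-+ (e ^ 3 + 2 * d ^ 2 * 1) (2 * 1)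
            (≤[]-+ (e ^ 3) (2 * d ^ 2 * 1) a b) c
  lhs : ∀ d A B → d * (d * (d * 1)) * (A + 2 * B + 2) ≡
        d * (d * (d * 1)) * A + 2 * (d * (d * 1)) * (d * B) + 2 * (d * (d * (d * 1)))
  lhs = solve-∀
  -- The slack d³ - e³ - 2 d² - 2 equals e² - e - 3. It is negative at e = 2, which is why
  -- codimension 3 is treated separately.
  rhs : ∀ f → let e = 3 + f; d = 4 + f in
        (e * (e * (e * 1)) + 2 * (d * (d * 1)) * 1 + 2 * 1) + (f * f + 5 * f + 3) ≡ d * (d * (d * 1)) * 1
  rhs = solve-∀
  D≤[]1 : D ≤[ q , X ] 1
  D≤[]1 = ≤[]-unscale (d ^ 3) (≤[]-mono
    (≤-trans (*-monoʳ-≤ (d ^ 3) D≤) (≤-reflexive (lhs d A B)))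
    (≤-trans (m≤m+n _ (f * f + 5 * f + 3)) (≤-reflexive (rhs f))) total)

-- With x ≥ 4 the comparison is made at j = 2: relative to x^(log d) the summands are at most e² /
-- d² and 4 / d², and e² + 4 ≤ d² for d = e + 1.
LePowLog₂-step-small : ∀ {A D x} e → 3 ≤ e → 4 ≤ x →
  LePowLog₂ A x e → D ≤ A + 4 → LePowLog₂ D x (suc e)
LePowLog₂-step-small {A} {D} {x} e@(suc (suc (suc f))) (s≤s (s≤s (s≤s _))) 4≤x A≤ D≤ p q 1≤q d^q<2^p
  = ≤[]1⁻ D≤[]1
  where
  d = suc e
  X = x ^ p
  instance
    _ = m^n≢0 e 2
    _ = m^n≢0 d 2
  a : d ^ 2 * A ≤[ q , X ] e ^ 2
  a = LePowLog₂-base 2 (n≤1+n e) A≤ 4≤x p q 1≤q d^q<2^p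
  c : 4 * d ^ 2 ≤[ q , X ] 4 * 1
  c = ≤[]-scale 4 (d^j≤x^log-d d 2 4≤x p q d^q<2^p)
  total : d ^ 2 * A + 4 * d ^ 2 ≤[ q , X ] e ^ 2 + 4 * 1
  total = ≤[]-+ (e ^ 2) (4 * 1) a c
  lhs : ∀ d A → d * (d * 1) * (A + 4) ≡ d * (d * 1) * A + 4 * (d * (d * 1))
  lhs = solve-∀
  rhs : ∀ f → let e = 3 + f; d = 4 + f in (e * (e * 1) + 4 * 1) + (2 * f + 3) ≡ d * (d * 1) * 1
  rhs = solve-∀
  D≤[]1 : D ≤[ q , X ] 1
  D≤[]1 = ≤[]-unscale (d ^ 2) (≤[]-mono
    (≤-trans (*-monoʳ-≤ (d ^ 2) D≤) (≤-reflexive (lhs d A)))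
    (≤-trans (m≤m+n _ (2 * f + 3)) (≤-reflexive (rhs f))) total)

-- Todd's estimate. If x < 8, then 2 y + 4 ≤ x forces y ≤ 1, hence B ≤ 1 and 2 B + 2 ≤ 4.
LePowLog₂-step : ∀ {A B D x y} e → 3 ≤ e → 2 * y + suc e ≤ x →
  LePowLog₂ A x e → LePowLog₂ B y (suc e) → D ≤ A + 2 * B + 2 → LePowLog₂ D x (suc e)
LePowLog₂-step {A} {B} {D} {x} {y} e 3≤e 2y+d≤x A≤ B≤ D≤ with 8 ≤? x
... | yes 8≤x = LePowLog₂-step-large e 3≤e 8≤x (m+n≤o⇒m≤o (2 * y) 2y+d≤x) A≤ B≤ D≤
... | no  8≰x = LePowLog₂-step-small e 3≤e (≤-trans (s≤s 3≤e) (m+n≤o⇒n≤o (2 * y) 2y+d≤x)) A≤ (begin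
    D                 ≤⟨ D≤ ⟩
    A + 2 * B + 2     ≤⟨ +-monoˡ-≤ 2 (+-monoʳ-≤ A (*-monoʳ-≤ 2 B≤1)) ⟩
    A + 2 + 2         ≡⟨ +-assoc A 2 2 ⟩
    A + 4             ∎)
  where
  open ≤-Reasoning
  y<2 : y < 2
  y<2 = *-cancelˡ-< 2 y 2 (+-cancelʳ-< 4 (2 * y) 4 (begin-strict
    2 * y + 4         ≤⟨ +-monoʳ-≤ (2 * y) (s≤s 3≤e) ⟩
    2 * y + suc e     ≤⟨ 2y+d≤x ⟩
    x                 <⟨ ≰⇒> 8≰x ⟩
    8                 ∎))
  B≤1 : B ≤ 1
  B≤1 = begin
    B                 ≡⟨ *-identityʳ B ⟨
    -- The pair p = d, q = 1 is admissible because d < 2^d.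
    B ^ 1             ≤⟨ B≤ (suc e) 1 ≤-refl (≤-<-trans (≤-reflexive (*-identityʳ (suc e))) (n<2^n (suc e))) ⟩
    y ^ suc e         ≤⟨ ^-monoˡ-≤ (suc e) (s≤s⁻¹ y<2) ⟩
    1 ^ suc e         ≡⟨ ^-zeroˡ (suc e) ⟩
    1                 ∎

-- log₂ 3 ≥ 3/2, as 2³ ≤ 3².
square≤cube⇒LePowLog₂-3 : ∀ {D x} → D ^ 2 ≤ x ^ 3 → LePowLog₂ D x 3
square≤cube⇒LePowLog₂-3 {D} {zero} D²≤0 p (suc q) 1≤q _ with m^n≡0⇒m≡0 D 2 (n≤0⇒n≡0 D²≤0)
... | refl = z≤n
square≤cube⇒LePowLog₂-3 {D} {x@(suc _)} D²≤x³ p q 1≤q 3^q<2^p = ^-cancelˡ-≤ 2 (begin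
  (D ^ q) ^ 2   ≡⟨ ^-comm D q 2 ⟩
  (D ^ 2) ^ q   ≤⟨ ^-monoˡ-≤ q D²≤x³ ⟩
  (x ^ 3) ^ q   ≡⟨ ^-*-assoc x 3 q ⟩
  x ^ (3 * q)   ≤⟨ ^-monoʳ-≤ x 3q≤p2 ⟩
  x ^ (p * 2)   ≡⟨ ^-*-assoc x p 2 ⟨
  (x ^ p) ^ 2   ∎)
  where
  open ≤-Reasoning
  3q≤p2 : 3 * q ≤ p * 2
  3q≤p2 = ≮⇒≥ λ p2<3q → <⇒≱ (^-monoʳ-< 2 (s≤s (s≤s z≤n)) p2<3q) (begin
    2 ^ (3 * q)   ≡⟨ ^-*-assoc 2 3 q ⟨
    8 ^ q         ≤⟨ ^-monoˡ-≤ q (n≤1+n 8) ⟩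
    9 ^ q         ≡⟨ ^-comm 3 2 q ⟩
    (3 ^ q) ^ 2   ≤⟨ ^-monoˡ-≤ 2 (<⇒≤ 3^q<2^p) ⟩
    (2 ^ p) ^ 2   ≡⟨ ^-*-assoc 2 p 2 ⟩
    2 ^ (p * 2)   ∎)

2mn≤m²+n² : ∀ m n → 2 * (m * n) ≤ m * m + n * n
2mn≤m²+n² m n with ≤-total m n
... | inj₁ m≤n = subst (λ n → 2 * (m * n) ≤ m * m + n * n) (m+[n∸m]≡n m≤n) (bound m (n ∸ m))
  where
  eq : ∀ m t → 2 * (m * (m + t)) + t * t ≡ m * m + (m + t) * (m + t)
  eq = solve-∀
  bound : ∀ m t → 2 * (m * (m + t)) ≤ m * m + (m + t) * (m + t)
  bound m t = ≤-trans (m≤m+n _ (t * t)) (≤-reflexive (eq m t))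
... | inj₂ n≤m = subst (λ m → 2 * (m * n) ≤ m * m + n * n) (m+[n∸m]≡n n≤m) (bound n (m ∸ n))
  where
  eq : ∀ n t → 2 * ((n + t) * n) + t * t ≡ (n + t) * (n + t) + n * n
  eq = solve-∀
  bound : ∀ n t → 2 * ((n + t) * n) ≤ (n + t) * (n + t) + n * n
  bound n t = ≤-trans (m≤m+n _ (t * t)) (≤-reflexive (eq n t))

-- With a = x + 2, the bound (a + 2 B)² ≤ 3 a² + 6 B² ≤ 3 a² + 6 y³ suffices when y ≥ 2;
-- it is too weak for y ≤ 1, where B ≤ y is used instead.
square≤cube-step : ∀ {A B D x y} → 2 * y + 3 ≤ x → A ≤ x → B ^ 2 ≤ y ^ 3 →
                   D ≤ A + 2 * B + 2 → D ^ 2 ≤ x ^ 3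
square≤cube-step {A} {B} {D} {x} {y} 2y+3≤x A≤x B²≤y³ D≤ =
  ≤-trans (^-monoˡ-≤ 2 (≤-trans D≤ (+-monoˡ-≤ 2 (+-monoˡ-≤ (2 * B) A≤x))))
    (subst (λ x → (x + 2 * B + 2) ^ 2 ≤ x ^ 3) (m+[n∸m]≡n 2y+3≤x) (bound y (x ∸ (2 * y + 3)) B²≤y³))
  where
  open ≤-Reasoning
  bound : ∀ y z → B ^ 2 ≤ y ^ 3 → ((2 * y + 3 + z) + 2 * B + 2) ^ 2 ≤ (2 * y + 3 + z) ^ 3
  bound zero z B²≤0 = begin
    (3 + z + 2 * B + 2) ^ 2     ≤⟨ ^-monoˡ-≤ 2 (+-monoˡ-≤ 2 (+-monoʳ-≤ (3 + z) (*-monoʳ-≤ 2 (^-cancelˡ-≤ 2 {B} {0} B²≤0)))) ⟩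
    (3 + z + 0 + 2) ^ 2         ≤⟨ m≤m+n _ (z * z * z + 8 * (z * z) + 17 * z + 2) ⟩
    (3 + z + 0 + 2) ^ 2 + (z * z * z + 8 * (z * z) + 17 * z + 2) ≡⟨ eq z ⟩
    (3 + z) ^ 3                 ∎
    where
    eq : ∀ z → (3 + z + 0 + 2) * ((3 + z + 0 + 2) * 1) + (z * z * z + 8 * (z * z) + 17 * z + 2) ≡
         (3 + z) * ((3 + z) * ((3 + z) * 1))
    eq = solve-∀
  bound (suc zero) z B²≤1 = begin
    (5 + z + 2 * B + 2) ^ 2     ≤⟨ ^-monoˡ-≤ 2 (+-monoˡ-≤ 2 (+-monoʳ-≤ (5 + z) (*-monoʳ-≤ 2 (^-cancelˡ-≤ 2 {B} {1} B²≤1)))) ⟩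
    (5 + z + 2 + 2) ^ 2         ≤⟨ m≤m+n _ (z * z * z + 14 * (z * z) + 57 * z + 44) ⟩
    (5 + z + 2 + 2) ^ 2 + (z * z * z + 14 * (z * z) + 57 * z + 44) ≡⟨ eq z ⟩
    (5 + z) ^ 3                 ∎
    where
    eq : ∀ z → (5 + z + 2 + 2) * ((5 + z + 2 + 2) * 1) + (z * z * z + 14 * (z * z) + 57 * z + 44) ≡
         (5 + z) * ((5 + z) * ((5 + z) * 1))
    eq = solve-∀
  bound y@(suc (suc u)) z B²≤y³ = begin
    (a z + 2 * B + 2) ^ 2                                       ≡⟨ expand (a z) B ⟩
    (a z + 2) * (a z + 2) + 2 * (2 * ((a z + 2) * B)) + 4 * (B ^ 2) ≤⟨ +-monoˡ-≤ (4 * (B ^ 2)) (+-monoʳ-≤ ((a z + 2) * (a z + 2)) (*-monoʳ-≤ 2 (2mn≤m²+n² (a z + 2) B))) ⟩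
    (a z + 2) * (a z + 2) + 2 * ((a z + 2) * (a z + 2) + B * B) + 4 * (B ^ 2) ≡⟨ collect (a z) B ⟩
    3 * ((a z + 2) * (a z + 2)) + 6 * (B ^ 2)                   ≤⟨ +-monoʳ-≤ (3 * ((a z + 2) * (a z + 2))) (*-monoʳ-≤ 6 B²≤y³) ⟩
    3 * ((a z + 2) * (a z + 2)) + 6 * (y ^ 3)                   ≤⟨ m≤m+n _ (rest u z) ⟩
    3 * ((a z + 2) * (a z + 2)) + 6 * (y ^ 3) + rest u z        ≡⟨ cubic u z ⟩
    a z ^ 3                                                     ∎
    where
    a : ℕ → ℕ
    a z = 2 * y + 3 + z
    -- The difference a³ - 3 (a + 2)² - 6 y³; after the substitution y = 2 + u all its coefficients
    -- are positive.
    rest : ℕ → ℕ → ℕ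
    rest u z = 52 + 114 * u + 93 * z + 36 * (u * u) + 72 * (u * z) + 18 * (z * z)
             + 2 * (u * u * u) + 12 * (u * u * z) + 6 * (u * z * z) + z * z * z
    expand : ∀ a b → (a + 2 * b + 2) * ((a + 2 * b + 2) * 1) ≡
             (a + 2) * (a + 2) + 2 * (2 * ((a + 2) * b)) + 4 * (b * (b * 1))
    expand = solve-∀
    collect : ∀ a b → (a + 2) * (a + 2) + 2 * ((a + 2) * (a + 2) + b * b) + 4 * (b * (b * 1)) ≡
              3 * ((a + 2) * (a + 2)) + 6 * (b * (b * 1))
    collect = solve-∀
    cubic : ∀ u z → let y = 2 + u; a = 2 * y + 3 + z in
            3 * ((a + 2) * (a + 2)) + 6 * (y * (y * (y * 1)))
            + (52 + 114 * u + 93 * z + 36 * (u * u) + 72 * (u * z) + 18 * (z * z)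
               + 2 * (u * u * u) + 12 * (u * u * z) + 6 * (u * z * z) + z * z * z)
            ≡ a * (a * (a * 1))
    cubic = solve-∀

-- Halving w instead of w - k leaves a surplus of k, which `square≤cube-step` and `LePowLog₂-step`
-- consume.
2[⌊w/2⌋∸k]+k≤w∸k : ∀ w k → k ≤ ⌊ w /2⌋ → 2 * (⌊ w /2⌋ ∸ k) + k ≤ w ∸ k
2[⌊w/2⌋∸k]+k≤w∸k w k k≤h = m+n≤o⇒m≤o∸n _ (begin
  2 * y + k + k             ≡⟨ eq y k ⟩
  (y + k) + (y + k)         ≡⟨ cong₂ _+_ (m∸n+n≡m k≤h) (m∸n+n≡m k≤h) ⟩
  ⌊ w /2⌋ + ⌊ w /2⌋         ≤⟨ +-monoʳ-≤ ⌊ w /2⌋ (⌊n/2⌋≤⌈n/2⌉ w) ⟩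
  ⌊ w /2⌋ + ⌈ w /2⌉         ≡⟨ ⌊n/2⌋+⌈n/2⌉≡n w ⟩
  w                         ∎)
  where
  open ≤-Reasoning
  y = ⌊ w /2⌋ ∸ k
  eq : ∀ y k → 2 * y + k + k ≡ (y + k) + (y + k)
  eq = solve-∀

-- Finite subsets

private variable n : ℕ

_≟ˢ_ : (p q : Subset n) → Dec (p ≡ q)
_≟ˢ_ = ≡-dec Bool._≟_

comprehension : {P : Fin n → Set} → Decidable P → Subset n
comprehension P? = tabulate (does ∘ P?)

module _ {P : Fin n → Set} (P? : Decidable P) where
  ∈-comprehension⁺ : ∀ {x} → P x → x ∈ comprehension P?
  ∈-comprehension⁺ {x} px =
    lookup⇒[]= x _ (trans (lookup∘tabulate (does ∘ P?) x) (dec-true (P? x) px))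

  ∈-comprehension⁻ : ∀ {x} → x ∈ comprehension P? → P x
  ∈-comprehension⁻ {x} x∈ with P? x | trans (sym (lookup∘tabulate (does ∘ P?) x)) ([]=⇒lookup x∈)
  ... | yes px | _ = px
  ... | no _   | ()

∣p∪q∣+∣p∩q∣ : ∀ (p q : Subset n) → ∣ p ∪ q ∣ + ∣ p ∩ q ∣ ≡ ∣ p ∣ + ∣ q ∣
∣p∪q∣+∣p∩q∣ [] [] = refl
∣p∪q∣+∣p∩q∣ (outside ∷ p) (outside ∷ q) = ∣p∪q∣+∣p∩q∣ p q
∣p∪q∣+∣p∩q∣ (outside ∷ p) (inside  ∷ q) = trans (cong suc (∣p∪q∣+∣p∩q∣ p q)) (sym (+-suc ∣ p ∣ ∣ q ∣))
∣p∪q∣+∣p∩q∣ (inside  ∷ p) (outside ∷ q) = cong suc (∣p∪q∣+∣p∩q∣ p q)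
∣p∪q∣+∣p∩q∣ (inside  ∷ p) (inside  ∷ q) = cong suc
  (trans (+-suc ∣ p ∪ q ∣ ∣ p ∩ q ∣) (trans (cong suc (∣p∪q∣+∣p∩q∣ p q)) (sym (+-suc ∣ p ∣ ∣ q ∣))))

x∈p─q⇒x∉q : ∀ (p q : Subset n) {x} → x ∈ p ─ q → x ∉ q
x∈p─q⇒x∉q (_ ∷ p) (inside  ∷ q) (there x∈) (there x∈q) = x∈p─q⇒x∉q p q x∈ x∈q
x∈p─q⇒x∉q (_ ∷ p) (outside ∷ q) (there x∈) (there x∈q) = x∈p─q⇒x∉q p q x∈ x∈q

∣p∣≤∣q∣+∣p─q∣ : ∀ (p q : Subset n) → ∣ p ∣ ≤ ∣ q ∣ + ∣ p ─ q ∣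
∣p∣≤∣q∣+∣p─q∣ p q = begin
  ∣ p ∣                               ≤⟨ p⊆q⇒∣p∣≤∣q∣ p⊆ ⟩
  ∣ q ∪ (p ─ q) ∣                     ≤⟨ m≤m+n _ _ ⟩
  ∣ q ∪ (p ─ q) ∣ + ∣ q ∩ (p ─ q) ∣   ≡⟨ ∣p∪q∣+∣p∩q∣ q (p ─ q) ⟩
  ∣ q ∣ + ∣ p ─ q ∣                   ∎
  where
  open ≤-Reasoning
  p⊆ : p ⊆ q ∪ (p ─ q)
  p⊆ {x} x∈p with x ∈? q
  ... | yes x∈q = p⊆p∪q (p ─ q) x∈q
  ... | no  x∉q = q⊆p∪q q (p ─ q) (x∈p∧x∉q⇒x∈p─q x∈p x∉q)

common-element : ∀ {p q r : Subset n} → p ⊆ r → q ⊆ r → ∣ r ∣ < ∣ p ∣ + ∣ q ∣ → ∃[ x ] (x ∈ p × x ∈ q)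
common-element {n} {p} {q} {r} p⊆r q⊆r ∣r∣< with nonempty? (p ∩ q)
... | yes (x , x∈) = x , x∈p∩q⁻ p q x∈
... | no  p∩q-empty = contradiction ∣r∣< (≤⇒≯ (begin
    ∣ p ∣ + ∣ q ∣          ≡⟨ ∣p∪q∣+∣p∩q∣ p q ⟨
    ∣ p ∪ q ∣ + ∣ p ∩ q ∣  ≡⟨ cong (λ s → ∣ p ∪ q ∣ + ∣ s ∣) (Empty-unique p∩q-empty) ⟩
    ∣ p ∪ q ∣ + ∣ ⊥ {n} ∣  ≡⟨ cong (∣ p ∪ q ∣ +_) (∣⊥∣≡0 n) ⟩
    ∣ p ∪ q ∣ + 0          ≡⟨ +-identityʳ ∣ p ∪ q ∣ ⟩
    ∣ p ∪ q ∣              ≤⟨ p⊆q⇒∣p∣≤∣q∣ ([ p⊆r , q⊆r ]′ ∘ x∈p∪q⁻ p q) ⟩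
    ∣ r ∣                  ∎))
  where open ≤-Reasoning

∣p∣<∣q∣⇒∃∈q∉p : ∀ {p q : Subset n} → ∣ p ∣ < ∣ q ∣ → ∃[ x ] (x ∈ q × x ∉ p)
∣p∣<∣q∣⇒∃∈q∉p {p = p} {q} ∣p∣<∣q∣ with nonempty? (q ─ p)
... | yes (x , x∈) = x , p─q⊆p q p x∈ , x∈p─q⇒x∉q q p x∈
... | no  q─p-empty = contradiction ∣p∣<∣q∣ (≤⇒≯ (p⊆q⇒∣p∣≤∣q∣ λ {x} x∈q →
    decidable-stable (x ∈? p) λ x∉p → q─p-empty (x , x∈p∧x∉q⇒x∈p─q x∈q x∉p)))

p⊆q∧∣q∣≤∣p∣⇒p≡q : ∀ {p q : Subset n} → p ⊆ q → ∣ q ∣ ≤ ∣ p ∣ → p ≡ q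
p⊆q∧∣q∣≤∣p∣⇒p≡q {p = p} p⊆q ∣q∣≤∣p∣ = ⊆-antisym p⊆q λ {x} x∈q →
  decidable-stable (x ∈? p) λ x∉p →
    contradiction (p⊂q⇒∣p∣<∣q∣ (p⊆q , x , x∈q , x∉p)) (≤⇒≯ ∣q∣≤∣p∣)

∪⁅⁆-⊆ : ∀ {p q : Subset n} {x} → p ⊆ q → x ∈ q → p ∪ ⁅ x ⁆ ⊆ q
∪⁅⁆-⊆ {p = p} {q} {x} p⊆q x∈q {y} y∈ with x∈p∪q⁻ p ⁅ x ⁆ y∈
... | inj₁ y∈p = p⊆q y∈p
... | inj₂ y∈x = subst (_∈ q) (sym (x∈⁅y⁆⇒x≡y x y∈x)) x∈q

∣p∪⁅x⁆∣ : ∀ {p : Subset n} {x} → x ∉ p → ∣ p ∪ ⁅ x ⁆ ∣ ≡ suc ∣ p ∣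
∣p∪⁅x⁆∣ {n} {p} {x} x∉p = begin
  ∣ p ∪ ⁅ x ⁆ ∣                     ≡⟨ +-identityʳ _ ⟨
  ∣ p ∪ ⁅ x ⁆ ∣ + 0                 ≡⟨ cong (∣ p ∪ ⁅ x ⁆ ∣ +_) (∣⊥∣≡0 n) ⟨
  ∣ p ∪ ⁅ x ⁆ ∣ + ∣ ⊥ {n} ∣         ≡⟨ cong (λ s → ∣ p ∪ ⁅ x ⁆ ∣ + ∣ s ∣) (Empty-unique disjoint) ⟨
  ∣ p ∪ ⁅ x ⁆ ∣ + ∣ p ∩ ⁅ x ⁆ ∣     ≡⟨ ∣p∪q∣+∣p∩q∣ p ⁅ x ⁆ ⟩
  ∣ p ∣ + ∣ ⁅ x ⁆ ∣                 ≡⟨ cong (∣ p ∣ +_) (∣⁅x⁆∣≡1 x) ⟩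
  ∣ p ∣ + 1                         ≡⟨ +-comm ∣ p ∣ 1 ⟩
  suc ∣ p ∣                         ∎
  where
  open ≡-Reasoning
  disjoint : ¬ (∃[ y ] y ∈ p ∩ ⁅ x ⁆)
  disjoint (y , y∈) = let y∈p , y∈x = x∈p∩q⁻ p ⁅ x ⁆ y∈ in
    x∉p (subst (_∈ p) (x∈⁅y⁆⇒x≡y x y∈x) y∈p)

∣p∪⁅x⁆∣+k≡d : ∀ {p : Subset n} {x k d} → x ∉ p → ∣ p ∣ + suc k ≡ d → ∣ p ∪ ⁅ x ⁆ ∣ + k ≡ d
∣p∪⁅x⁆∣+k≡d {p = p} {k = k} x∉p size =
  trans (cong (_+ k) (∣p∪⁅x⁆∣ x∉p)) (trans (sym (+-suc ∣ p ∣ k)) size)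

-- Stars, layers and the recursion

module _ {d n : ℕ} (K : PureComplex d n) where
  open PureComplex K

  StarAdj : Subset n → Subset n → Subset n → Set
  StarAdj σ F G = DualAdj K F G × σ ⊆ F × σ ⊆ G

  StarAdj-⊆ : ∀ {σ τ F G} → σ ⊆ τ → StarAdj τ F G → StarAdj σ F G
  StarAdj-⊆ σ⊆τ (adj , τ⊆F , τ⊆G) = adj , (λ x∈σ → τ⊆F (σ⊆τ x∈σ)) , (λ x∈σ → τ⊆G (σ⊆τ x∈σ))

  DualAdj-sym : ∀ {F G} → DualAdj K F G → DualAdj K G F
  DualAdj-sym {F} {G} (F∈ , G∈ , ∣F∩G∣) = G∈ , F∈ , trans (cong ∣_∣ (∩-comm G F)) ∣F∩G∣

  -- The common face σ has at least d - 1 vertices, while distinct facets meet in fewer than d.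
  codim≤1⇒adjacent : ∀ {σ F G k} → k ≤ 1 → ∣ σ ∣ + k ≡ d → F L.∈ facets → G L.∈ facets →
                     σ ⊆ F → σ ⊆ G → F ≡ G ⊎ DualAdj K F G
  codim≤1⇒adjacent {σ} {F} {G} {k} k≤1 size F∈ G∈ σ⊆F σ⊆G with F ≟ˢ G
  ... | yes F≡G = inj₁ F≡G
  ... | no  F≢G = inj₂ (F∈ , G∈ , ≤-antisym (<⇒≤pred ∣F∩G∣<d) d∸1≤∣F∩G∣)
    where
    ∣F∩G∣<d : ∣ F ∩ G ∣ < d
    ∣F∩G∣<d = ≰⇒> λ d≤ → F≢G (trans
      (sym (p⊆q∧∣q∣≤∣p∣⇒p≡q (p∩q⊆p F G) (≤-trans (≤-reflexive (facets-size F∈)) d≤)))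
      (p⊆q∧∣q∣≤∣p∣⇒p≡q (p∩q⊆q F G) (≤-trans (≤-reflexive (facets-size G∈)) d≤)))
    d∸1≤∣F∩G∣ : d ∸ 1 ≤ ∣ F ∩ G ∣
    d∸1≤∣F∩G∣ = begin
      d ∸ 1               ≤⟨ ∸-monoʳ-≤ d k≤1 ⟩
      d ∸ k               ≡⟨ cong (_∸ k) size ⟨
      ∣ σ ∣ + k ∸ k       ≡⟨ m+n∸n≡m ∣ σ ∣ k ⟩
      ∣ σ ∣               ≤⟨ p⊆q⇒∣p∣≤∣q∣ (λ x∈σ → x∈p∩q⁺ (σ⊆F x∈σ , σ⊆G x∈σ)) ⟩
      ∣ F ∩ G ∣           ∎
      where open ≤-Reasoning

  -- Dual connectivity of stars

  module _ (normal : Normal K) where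

    -- Induction on the codimension k. For k ≥ 2, vertices u of F and v of G outside σ are joined by
    -- a path in the link of σ, which is connected as σ has at most d - 2 vertices.
    star-connected : ∀ k {σ F G} → ∣ σ ∣ + k ≡ d → F L.∈ facets → G L.∈ facets →
                     σ ⊆ F → σ ⊆ G → Star (StarAdj σ) F G

    -- A path u, u′, … in the link lifts: consecutive facets containing
    -- σ ∪ {u} are joined inside the star of σ ∪ {u}.
    star-connected-along : ∀ k {σ F G u v} → ∣ σ ∣ + suc k ≡ d → F L.∈ facets → G L.∈ facets →
      σ ⊆ F → σ ⊆ G → u ∉ σ → u ∈ F → v ∈ G → Star (LinkEdge K σ) u v → Star (StarAdj σ) F G

    star-connected zero size F∈ G∈ σ⊆F σ⊆G with codim≤1⇒adjacent z≤n size F∈ G∈ σ⊆F σ⊆G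
    ... | inj₁ refl = ε
    ... | inj₂ adj  = (adj , σ⊆F , σ⊆G) ◅ ε
    star-connected (suc zero) size F∈ G∈ σ⊆F σ⊆G with codim≤1⇒adjacent ≤-refl size F∈ G∈ σ⊆F σ⊆G
    ... | inj₁ refl = ε
    ... | inj₂ adj  = (adj , σ⊆F , σ⊆G) ◅ ε
    star-connected (suc k@(suc k′)) {σ} {F} {G} size F∈ G∈ σ⊆F σ⊆G =
      star-connected-along k size F∈ G∈ σ⊆F σ⊆G u∉σ u∈F v∈G
        (proj₂ normal σ (F , F∈ , σ⊆F) ∣σ∣≤d∸2 u v
          (u∉σ , F , F∈ , ∪⁅⁆-⊆ σ⊆F u∈F) (v∉σ , G , G∈ , ∪⁅⁆-⊆ σ⊆G v∈G))
      where
      ∣σ∣<∣facet∣ : ∀ {H} → H L.∈ facets → ∣ σ ∣ < ∣ H ∣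
      ∣σ∣<∣facet∣ H∈ = subst (∣ σ ∣ <_) (trans size (sym (facets-size H∈))) (m<m+n ∣ σ ∣ (s≤s z≤n))
      new-in-F = ∣p∣<∣q∣⇒∃∈q∉p (∣σ∣<∣facet∣ F∈)
      u = proj₁ new-in-F
      u∈F = proj₁ (proj₂ new-in-F)
      u∉σ = proj₂ (proj₂ new-in-F)
      new-in-G = ∣p∣<∣q∣⇒∃∈q∉p (∣σ∣<∣facet∣ G∈)
      v = proj₁ new-in-G
      v∈G = proj₁ (proj₂ new-in-G)
      v∉σ = proj₂ (proj₂ new-in-G)
      ∣σ∣≤d∸2 : ∣ σ ∣ ≤ d ∸ 2
      ∣σ∣≤d∸2 = m+n≤o⇒m≤o∸n ∣ σ ∣ (≤-trans (+-monoʳ-≤ ∣ σ ∣ (s≤s (s≤s z≤n))) (≤-reflexive size))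

    star-connected-along k {σ} {F} {G} {u} size F∈ G∈ σ⊆F σ⊆G u∉σ u∈F u∈G ε =
      Star.map (StarAdj-⊆ (p⊆p∪q ⁅ u ⁆))
        (star-connected k (∣p∪⁅x⁆∣+k≡d u∉σ size) F∈ G∈ (∪⁅⁆-⊆ σ⊆F u∈F) (∪⁅⁆-⊆ σ⊆G u∈G))
    star-connected-along k {σ} {F} {G} {u} size F∈ G∈ σ⊆F σ⊆G u∉σ u∈F v∈G
      (_◅_ {j = u′} (_ , u′∉σ , H , H∈ , ⊆H) path) =
      Star.map (StarAdj-⊆ (p⊆p∪q ⁅ u ⁆))
        (star-connected k (∣p∪⁅x⁆∣+k≡d u∉σ size) F∈ H∈ (∪⁅⁆-⊆ σ⊆F u∈F) (∪⁅⁆-⊆ σ⊆H u∈H))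
        ◅◅ star-connected-along k size H∈ G∈ σ⊆H σ⊆G u′∉σ u′∈H v∈G path
      where
      σ⊆H : σ ⊆ H
      σ⊆H = ⊆H ∘ p⊆p∪q (⁅ u ⁆ ∪ ⁅ u′ ⁆)
      u∈H : u ∈ H
      u∈H = ⊆H (q⊆p∪q σ _ (p⊆p∪q ⁅ u′ ⁆ (x∈⁅x⁆ u)))
      u′∈H : u′ ∈ H
      u′∈H = ⊆H (q⊆p∪q σ _ (q⊆p∪q ⁅ u ⁆ _ (x∈⁅x⁆ u′)))

  -- Layers of a Lipschitz function on the facets of a star

  module Layers
    (ℓ : Subset n → ℕ)
    (ℓ-lipschitz : ∀ {F G} → DualAdj K F G → ℓ F ≤ suc (ℓ G))
    (connected : ∀ k {σ F G} → ∣ σ ∣ + k ≡ d → F L.∈ facets → G L.∈ facets →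
                 σ ⊆ F → σ ⊆ G → Star (StarAdj σ) F G)
    where

    -- `F` and `G` witness that the two end layers of the interval are attained in the star of σ.
    record Span (σ F G : Subset n) : Set where
      constructor span
      field
        F∈  : F L.∈ facets
        G∈  : G L.∈ facets
        σ⊆F : σ ⊆ F
        σ⊆G : σ ⊆ G
        F≤G : ℓ F ≤ ℓ G

    InLayers : Subset n → ℕ → ℕ → Fin n → Set
    InLayers σ a b x = x ∉ σ × ∃[ H ] (H L.∈ facets × σ ⊆ H × a ≤ ℓ H × ℓ H ≤ b × x ∈ H)

    inLayers? : ∀ σ a b → Decidable (InLayers σ a b)
    inLayers? σ a b x = ¬? (x ∈? σ) ×-dec
      map′ L.find (λ (_ , H∈ , rest) → L.lose H∈ rest)
        (any? (λ H → (σ ⊆? H) ×-dec (a ≤? ℓ H) ×-dec (ℓ H ≤? b) ×-dec (x ∈? H)) facets)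

    vertices : Subset n → ℕ → ℕ → Subset n
    vertices σ a b = comprehension (inLayers? σ a b)

    vertices-mono : ∀ {σ a b a′ b′} → a′ ≤ a → b ≤ b′ → vertices σ a b ⊆ vertices σ a′ b′
    vertices-mono {σ} {a} {b} {a′} {b′} a′≤a b≤b′ x∈ with ∈-comprehension⁻ (inLayers? σ a b) x∈
    ... | x∉σ , H , H∈ , σ⊆H , a≤H , H≤b , x∈H =
      ∈-comprehension⁺ (inLayers? σ a′ b′) (x∉σ , H , H∈ , σ⊆H , ≤-trans a′≤a a≤H , ≤-trans H≤b b≤b′ , x∈H)

    vertices-∪⁅⁆ : ∀ {σ a b v} → vertices (σ ∪ ⁅ v ⁆) a b ⊆ vertices σ a b - v
    vertices-∪⁅⁆ {σ} {a} {b} {v} {x} x∈ with ∈-comprehension⁻ (inLayers? (σ ∪ ⁅ v ⁆) a b) x∈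
    ... | x∉ , H , H∈ , σv⊆H , rest = x∈p∧x≢y⇒x∈p-y
      (∈-comprehension⁺ (inLayers? σ a b) (x∉ ∘ p⊆p∪q ⁅ v ⁆ , H , H∈ , σv⊆H ∘ p⊆p∪q ⁅ v ⁆ , rest))
      (λ { refl → x∉ (q⊆p∪q σ ⁅ v ⁆ (x∈⁅x⁆ v)) })

    F─σ⊆vertices : ∀ {σ F a b} → F L.∈ facets → σ ⊆ F → a ≤ ℓ F → ℓ F ≤ b → F ─ σ ⊆ vertices σ a b
    F─σ⊆vertices {σ} {F} {a} {b} F∈ σ⊆F a≤F F≤b x∈ = ∈-comprehension⁺ (inLayers? σ a b)
      (x∈p─q⇒x∉q F σ x∈ , F , F∈ , σ⊆F , a≤F , F≤b , p─q⊆p F σ x∈)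

    k≤∣F─σ∣ : ∀ {σ F k} → ∣ σ ∣ + k ≡ d → F L.∈ facets → k ≤ ∣ F ─ σ ∣
    k≤∣F─σ∣ {σ} {F} {k} size F∈ = +-cancelˡ-≤ ∣ σ ∣ _ _ (begin
      ∣ σ ∣ + k           ≡⟨ size ⟩
      d                   ≡⟨ facets-size F∈ ⟨
      ∣ F ∣               ≤⟨ ∣p∣≤∣q∣+∣p─q∣ F σ ⟩
      ∣ σ ∣ + ∣ F ─ σ ∣   ∎)
      where open ≤-Reasoning

    k≤∣vertices∣ : ∀ {σ F k a b} → ∣ σ ∣ + k ≡ d → F L.∈ facets → σ ⊆ F → a ≤ ℓ F → ℓ F ≤ b →
                   k ≤ ∣ vertices σ a b ∣
    k≤∣vertices∣ size F∈ σ⊆F a≤F F≤b =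
      ≤-trans (k≤∣F─σ∣ size F∈) (p⊆q⇒∣p∣≤∣q∣ (F─σ⊆vertices F∈ σ⊆F a≤F F≤b))

    -- A discrete intermediate value theorem: ℓ rises by at most one along each dual edge.
    intermediate-layer : ∀ {σ F G} c → F L.∈ facets → σ ⊆ F → Star (StarAdj σ) F G →
                         ℓ F ≤ c → c ≤ ℓ G → ∃[ H ] (H L.∈ facets × σ ⊆ H × ℓ H ≡ c)
    intermediate-layer {F = F} c F∈ σ⊆F path F≤c c≤G with ℓ F ≟ c
    ... | yes F≡c = F , F∈ , σ⊆F , F≡c
    intermediate-layer c F∈ σ⊆F ε F≤c c≤F | no F≢c = contradiction (≤-antisym F≤c c≤F) F≢c
    intermediate-layer c F∈ σ⊆F ((adj , _ , σ⊆H) ◅ path) F≤c c≤G | no F≢c =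
      intermediate-layer c (proj₁ (proj₂ adj)) σ⊆H path
        (≤-trans (ℓ-lipschitz (DualAdj-sym adj)) (≤∧≢⇒< F≤c F≢c)) c≤G

    layer : ∀ {σ F G k} c → ∣ σ ∣ + k ≡ d → Span σ F G → ℓ F ≤ c → c ≤ ℓ G →
            ∃[ H ] (H L.∈ facets × σ ⊆ H × ℓ H ≡ c)
    layer {k = k} c size (span F∈ G∈ σ⊆F σ⊆G _) =
      intermediate-layer c F∈ σ⊆F (connected k size F∈ G∈ σ⊆F σ⊆G)

    -- The bound is a predicate on lengths rather than a number, so that it can stand for a real
    -- bound such as (w - k)^(log k).
    Bounded : ℕ → ℕ → (ℕ → Set) → Set
    Bounded k w B = ∀ {σ F G} → ∣ σ ∣ + k ≡ d → Span σ F G →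
                    ∣ vertices σ (ℓ F) (ℓ G) ∣ ≤ w → B (ℓ G ∸ ℓ F)

    Bounded-empty : ∀ k B → Bounded (suc k) 0 B
    Bounded-empty k B size (span F∈ _ σ⊆F _ F≤G) ∣V∣≤0 =
      contradiction (≤-trans (k≤∣vertices∣ size F∈ σ⊆F ≤-refl F≤G) ∣V∣≤0) λ ()

    -- A is the length of the crossing inside a smaller star, B the larger of the two halves, and 2
    -- counts the layers at which the halves first exceed h vertices. The left alternative arises
    -- when both halves stop at once.
    Recursion : ℕ → ℕ → (ℕ → Set) → (ℕ → Set) → ℕ → Set
    Recursion k h B₁ B₂ D = ∃[ A ] (B₁ A × (D ≤ A ⊎ k ≤ h × ∃[ B ] (B₂ B × D ≤ A + 2 * B + 2)))

    -- The Kalai–Kleitman recursion: the layers seen from F and those seen from G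
    -- are each followed until they use more than half of the vertices. They then
    -- share a vertex v, and the remaining layers are crossed inside the star of v.
    halving : ∀ k w B₁ B₂ → B₁ 0 → Bounded k w B₁ → Bounded (suc k) ⌊ suc w /2⌋ B₂ →
              Bounded (suc k) (suc w) (Recursion (suc k) ⌊ suc w /2⌋ B₁ B₂)
    halving k w B₁ B₂ B₁-zero bound₁ bound₂ {σ} {F} {G} size FG@(span F∈ G∈ σ⊆F σ⊆G F≤G) ∣V∣≤w
      with ∣ vertices σ (ℓ F) (ℓ G) ∣ ≤? ⌊ suc w /2⌋
    -- The whole interval fits into half of the vertices, so it serves as B itself, with A = 0.
    ... | yes ∣V∣≤h = 0 , B₁-zero ,
          inj₂ (≤-trans (k≤∣vertices∣ size F∈ σ⊆F ≤-refl F≤G) ∣V∣≤h , D , bound₂ size FG ∣V∣≤h ,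
                ≤-trans (m≤m+n D (D + 0)) (m≤m+n (2 * D) 2))
      where D = ℓ G ∸ ℓ F
    ... | no  ∣V∣≰h = conclude
      where
      h = ⌊ suc w /2⌋
      a = ℓ F
      b = ℓ G
      D = b ∸ a
      up : ℕ → Subset n
      up t = vertices σ a (a + t)
      down : ℕ → Subset n
      down t = vertices σ (b ∸ t) b

      h<∣up-D∣ : h < ∣ up D ∣
      h<∣up-D∣ = subst (λ c → h < ∣ vertices σ a c ∣) (sym (m+[n∸m]≡n F≤G)) (≰⇒> ∣V∣≰h)
      h<∣down-D∣ : h < ∣ down D ∣
      h<∣down-D∣ = subst (λ c → h < ∣ vertices σ c b ∣) (sym (m∸[m∸n]≡n F≤G)) (≰⇒> ∣V∣≰h)
      a≤b∸ : ∀ {t} → t ≤ D → a ≤ b ∸ t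
      a≤b∸ t≤D = ≤-trans (≤-reflexive (sym (m∸[m∸n]≡n F≤G))) (∸-monoʳ-≤ b t≤D)
      a+≤b : ∀ {s} → s ≤ D → a + s ≤ b
      a+≤b s≤D = ≤-trans (+-monoʳ-≤ a s≤D) (≤-reflexive (m+[n∸m]≡n F≤G))

      -- s is the first radius using more than h vertices. Unless it is 0, its predecessor s′ still
      -- fits into h vertices, and B₂ applies to s′.
      Half : ℕ → Set
      Half s = s ≡ 0 ⊎ ∃[ s′ ] (s ≡ suc s′ × suc k ≤ h × B₂ s′)

      up-half : ∀ s → s ≤ D → (∀ r → h < ∣ up r ∣ → s ≤ r) → Half s
      up-half zero _ _ = inj₁ refl
      -- A facet in layer a + s, the last one before the threshold, ends the interval to which
      -- `bound₂` is applied.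
      up-half (suc s) s<D min with layer (a + s) size FG (m≤m+n a s) (a+≤b (<⇒≤ s<D))
      ... | H , H∈ , σ⊆H , H≡ = inj₂ (s , refl ,
            ≤-trans (k≤∣vertices∣ size F∈ σ⊆F ≤-refl (m≤m+n a s)) ∣up∣≤h ,
            subst B₂ (trans (cong (_∸ a) H≡) (m+n∸m≡n a s))
              (bound₂ size (span F∈ H∈ σ⊆F σ⊆H (≤-trans (m≤m+n a s) (≤-reflexive (sym H≡))))
                (subst (λ c → ∣ vertices σ a c ∣ ≤ h) (sym H≡) ∣up∣≤h)))
        where
        ∣up∣≤h : ∣ up s ∣ ≤ h
        ∣up∣≤h = ≮⇒≥ λ h<∣up∣ → 1+n≰n (min s h<∣up∣)

      down-half : ∀ t → t ≤ D → (∀ r → h < ∣ down r ∣ → t ≤ r) → Half t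
      down-half zero _ _ = inj₁ refl
      down-half (suc t) t<D min with layer (b ∸ t) size FG (a≤b∸ (<⇒≤ t<D)) (m∸n≤m b t)
      ... | H , H∈ , σ⊆H , H≡ = inj₂ (t , refl ,
            ≤-trans (k≤∣vertices∣ size G∈ σ⊆G (m∸n≤m b t) ≤-refl) ∣down∣≤h ,
            subst B₂ (trans (cong (b ∸_) H≡) (m∸[m∸n]≡n (≤-trans (<⇒≤ t<D) (m∸n≤m b a))))
              (bound₂ size (span H∈ G∈ σ⊆H σ⊆G (≤-trans (≤-reflexive H≡) (m∸n≤m b t)))
                (subst (λ c → ∣ vertices σ c b ∣ ≤ h) (sym H≡) ∣down∣≤h)))
        where
        ∣down∣≤h : ∣ down t ∣ ≤ h
        ∣down∣≤h = ≮⇒≥ λ h<∣down∣ → 1+n≰n (min t h<∣down∣)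

      1+w<2+2h : suc w < suc h + suc h
      1+w<2+2h = begin-strict
        suc w             ≡⟨ ⌊n/2⌋+⌈n/2⌉≡n (suc w) ⟨
        -- `⌈ suc w /2⌉` unfolds to `⌊ 2 + w /2⌋`, which is at most `⌊ 3 + w /2⌋`, that is `suc h`.
        h + ⌈ suc w /2⌉   ≤⟨ +-monoʳ-≤ h (⌊n/2⌋-mono (n≤1+n (suc (suc w)))) ⟩
        h + suc h         <⟨ ≤-refl ⟩
        suc h + suc h     ∎
        where open ≤-Reasoning

      common : ∀ {s t} → s ≤ D → t ≤ D → h < ∣ up s ∣ → h < ∣ down t ∣ → ∃[ v ] (v ∈ up s × v ∈ down t)
      common s≤D t≤D h<∣up∣ h<∣down∣ =
        common-element (vertices-mono ≤-refl (a+≤b s≤D)) (vertices-mono (a≤b∸ t≤D) ≤-refl)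
          (≤-<-trans ∣V∣≤w (<-≤-trans 1+w<2+2h (+-mono-≤ h<∣up∣ h<∣down∣)))

      combine : ∀ {s t} A → D ≤ A + (s + t) → Half s → Half t →
                D ≤ A ⊎ suc k ≤ h × ∃[ B ] (B₂ B × D ≤ A + 2 * B + 2)
      combine A D≤ (inj₁ refl) (inj₁ refl) = inj₁ (≤-trans D≤ (≤-reflexive (+-identityʳ A)))
      combine A D≤ (inj₁ refl) (inj₂ (t , refl , k≤h , t-bound)) =
        inj₂ (k≤h , t , t-bound , ≤-trans D≤ (≤-trans (m≤m+n _ (t + 1)) (≤-reflexive (eq A t))))
        where
        eq : ∀ A t → A + suc t + (t + 1) ≡ A + 2 * t + 2
        eq = solve-∀
      combine A D≤ (inj₂ (s , refl , k≤h , s-bound)) (inj₁ refl) =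
        inj₂ (k≤h , s , s-bound , ≤-trans D≤ (≤-trans (m≤m+n _ (s + 1)) (≤-reflexive (eq A s))))
        where
        eq : ∀ A s → A + (suc s + 0) + (s + 1) ≡ A + 2 * s + 2
        eq = solve-∀
      combine A D≤ (inj₂ (s , refl , k≤h , s-bound)) (inj₂ (t , refl , _ , t-bound)) with ≤-total s t
      ... | inj₁ s≤t = inj₂ (k≤h , t , t-bound ,
              ≤-trans D≤ (≤-trans (+-monoʳ-≤ A (+-monoˡ-≤ (suc t) (s≤s s≤t))) (≤-reflexive (eq A t))))
        where
        eq : ∀ A t → A + (suc t + suc t) ≡ A + 2 * t + 2
        eq = solve-∀
      ... | inj₂ t≤s = inj₂ (k≤h , s , s-bound ,
              ≤-trans D≤ (≤-trans (+-monoʳ-≤ A (+-monoʳ-≤ (suc s) (s≤s t≤s))) (≤-reflexive (eq A s))))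
        where
        eq : ∀ A s → A + (suc s + suc s) ≡ A + 2 * s + 2
        eq = solve-∀

      crossing : ∀ {s t v} → s ≤ D → t ≤ D → v ∈ up s → v ∈ down t → ∃[ A ] (B₁ A × D ≤ A + (s + t))
      crossing {s} {t} {v} s≤D t≤D v∈up v∈down with ∈-comprehension⁻ (inLayers? σ a (a + s)) v∈up
                                                  | ∈-comprehension⁻ (inLayers? σ (b ∸ t) b) v∈down
      ... | v∉σ , F′ , F′∈ , σ⊆F′ , a≤F′ , F′≤a+s , v∈F′
          | _   , G′ , G′∈ , σ⊆G′ , b∸t≤G′ , G′≤b , v∈G′ = A , A-bound , D≤
        where
        A = ℓ G′ ∸ ℓ F′
        v∈V : v ∈ vertices σ a b
        v∈V = vertices-mono ≤-refl (a+≤b s≤D) v∈up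
        A-bound : B₁ A
        A-bound with ℓ F′ ≤? ℓ G′
        -- The two growths already overlap, and truncated subtraction makes A zero.
        ... | no  F′≰G′ = subst B₁ (sym (m≤n⇒m∸n≡0 (<⇒≤ (≰⇒> F′≰G′)))) B₁-zero
        -- Adding v to the face removes it from the outside vertices, so at most w of the `suc w`
        -- remain.
        ... | yes F′≤G′ = bound₁ (∣p∪⁅x⁆∣+k≡d v∉σ size)
                (span F′∈ G′∈ (∪⁅⁆-⊆ σ⊆F′ v∈F′) (∪⁅⁆-⊆ σ⊆G′ v∈G′) F′≤G′)
                (s≤s⁻¹ (begin-strict
                  ∣ vertices (σ ∪ ⁅ v ⁆) (ℓ F′) (ℓ G′) ∣  ≤⟨ p⊆q⇒∣p∣≤∣q∣ (vertices-mono a≤F′ G′≤b) ⟩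
                  ∣ vertices (σ ∪ ⁅ v ⁆) a b ∣            ≤⟨ p⊆q⇒∣p∣≤∣q∣ (vertices-∪⁅⁆ {σ} {a} {b} {v}) ⟩
                  ∣ vertices σ a b - v ∣                  <⟨ x∈p⇒∣p-x∣<∣p∣ v∈V ⟩
                  ∣ vertices σ a b ∣                      ≤⟨ ∣V∣≤w ⟩
                  suc w                                   ∎))
          where open ≤-Reasoning
        D≤ : D ≤ A + (s + t)
        D≤ = m≤n+o⇒m∸n≤o b a (begin
          b                         ≤⟨ m≤n+m∸n b t ⟩
          t + (b ∸ t)               ≤⟨ +-monoʳ-≤ t b∸t≤G′ ⟩
          t + ℓ G′                  ≤⟨ +-monoʳ-≤ t (m≤n+m∸n (ℓ G′) (ℓ F′)) ⟩
          t + (ℓ F′ + A)            ≤⟨ +-monoʳ-≤ t (+-monoˡ-≤ A F′≤a+s) ⟩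
          t + (a + s + A)           ≡⟨ eq t a s A ⟩
          a + (A + (s + t))         ∎)
          where
          open ≤-Reasoning
          eq : ∀ t a s A → t + (a + s + A) ≡ a + (A + (s + t))
          eq = solve-∀

      conclude : Recursion (suc k) h B₁ B₂ D
      conclude with least (λ s → h <? ∣ up s ∣) D h<∣up-D∣ | least (λ t → h <? ∣ down t ∣) D h<∣down-D∣
      ... | s , h<∣up∣ , s-min | t , h<∣down∣ , t-min
        with s-min D h<∣up-D∣ | t-min D h<∣down-D∣
      ... | s≤D | t≤D with common s≤D t≤D h<∣up∣ h<∣down∣
      ... | v , v∈up , v∈down with crossing s≤D t≤D v∈up v∈down
      ... | A , A-bound , D≤ =
        A , A-bound , combine A D≤ (up-half s s≤D s-min) (down-half t t≤D t-min)

    -- In codimension 2 a facet shares no vertex outside σ with a facet two or more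
    -- layers away, so every second layer contributes two new vertices.
    codim2-vertices : ∀ D {σ F G} → ∣ σ ∣ + 2 ≡ d → Span σ F G → ℓ G ≡ ℓ F + D →
                      D + 2 ≤ ∣ vertices σ (ℓ F) (ℓ G) ∣
    codim2-vertices zero size (span F∈ G∈ σ⊆F σ⊆G F≤G) _ = k≤∣vertices∣ size F∈ σ⊆F ≤-refl F≤G
    codim2-vertices (suc zero) {σ} {F} {G} size (span F∈ G∈ σ⊆F σ⊆G F≤G) G≡1+F =
      ≤-<-trans (k≤∣F─σ∣ size F∈) (p⊂q⇒∣p∣<∣q∣
        (F─σ⊆vertices F∈ σ⊆F ≤-refl F≤G , new))
      where
      V = vertices σ (ℓ F) (ℓ G)
      F≢G : F ≢ G
      F≢G refl = m≢1+m+n (ℓ F) (trans G≡1+F (trans (+-comm (ℓ F) 1) (cong suc (sym (+-identityʳ (ℓ F))))))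
      new : ∃[ x ] (x ∈ V × x ∉ F ─ σ)
      new with nonempty? (G ─ F)
      -- F supplies two vertices outside σ; a vertex of G missing from F is the third.
      ... | yes (x , x∈) = x ,
            F─σ⊆vertices G∈ σ⊆G F≤G ≤-refl (x∈p∧x∉q⇒x∈p─q (p─q⊆p G F x∈) (x∈p─q⇒x∉q G F x∈ ∘ σ⊆F)) ,
            x∈p─q⇒x∉q G F x∈ ∘ p─q⊆p F σ
      ... | no  G─F-empty = contradiction
            (sym (p⊆q∧∣q∣≤∣p∣⇒p≡q {p = G} {F}
              (λ {x} x∈G → decidable-stable (x ∈? F) λ x∉F → G─F-empty (x , x∈p∧x∉q⇒x∈p─q x∈G x∉F))
              (≤-reflexive (trans (facets-size F∈) (sym (facets-size G∈))))))
            F≢G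
    codim2-vertices (suc (suc D)) {σ} {F} {G} size FG@(span F∈ G∈ σ⊆F σ⊆G F≤G) G≡ with
      layer (ℓ F + 2) size FG (m≤m+n (ℓ F) 2) (≤-trans (+-monoʳ-≤ (ℓ F) (m≤m+n 2 D)) (≤-reflexive (sym G≡)))
    ... | H , H∈ , σ⊆H , H≡ = begin
        2 + D + 2                                     ≡⟨ +-comm 2 (D + 2) ⟩
        D + 2 + 2                                     ≤⟨ +-mono-≤ (codim2-vertices D size HG G≡H+D) (k≤∣F─σ∣ size F∈) ⟩
        ∣ vertices σ (ℓ H) (ℓ G) ∣ + ∣ F ─ σ ∣        ≤⟨ ≮⇒≥ (disjoint ∘
          common-element (vertices-mono F≤H ≤-refl) (F─σ⊆vertices F∈ σ⊆F ≤-refl F≤G)) ⟩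
        ∣ vertices σ (ℓ F) (ℓ G) ∣                    ∎
      where
      open ≤-Reasoning
      G≡H+D : ℓ G ≡ ℓ H + D
      G≡H+D = trans G≡ (trans (sym (+-assoc (ℓ F) 2 D)) (cong (_+ D) (sym H≡)))
      HG : Span σ H G
      HG = span H∈ G∈ σ⊆H σ⊆G (≤-trans (m≤m+n (ℓ H) D) (≤-reflexive (sym G≡H+D)))
      F≤H : ℓ F ≤ ℓ H
      F≤H = ≤-trans (m≤m+n (ℓ F) 2) (≤-reflexive (sym H≡))
      disjoint : ¬ (∃[ x ] (x ∈ vertices σ (ℓ H) (ℓ G) × x ∈ F ─ σ))
      disjoint (x , x∈V , x∈F─σ) with ∈-comprehension⁻ (inLayers? σ (ℓ H) (ℓ G)) x∈V
      ... | x∉σ , I , I∈ , σ⊆I , H≤I , _ , x∈I = 1+n≰n (begin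
          suc (suc (ℓ F))   ≡⟨ +-comm 2 (ℓ F) ⟩
          ℓ F + 2           ≡⟨ H≡ ⟨
          ℓ H               ≤⟨ H≤I ⟩
          ℓ I               ≤⟨ I≤1+F ⟩
          suc (ℓ F)         ∎)
        where
        -- I and F share σ together with x, a face of codimension 1, so they are equal or adjacent.
        I≤1+F : ℓ I ≤ suc (ℓ F)
        I≤1+F with codim≤1⇒adjacent ≤-refl (∣p∪⁅x⁆∣+k≡d x∉σ size) I∈ F∈
                     (∪⁅⁆-⊆ σ⊆I x∈I) (∪⁅⁆-⊆ σ⊆F (p─q⊆p F σ x∈F─σ))
        ... | inj₁ refl = n≤1+n (ℓ I)
        ... | inj₂ adj  = ℓ-lipschitz adj

    -- Bounds for codimension 2, 3 and above

    bounded₂ : ∀ w → Bounded 2 w (_≤ w ∸ 2)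
    bounded₂ w {σ} {F} {G} size FG ∣V∣≤w = m+n≤o⇒m≤o∸n (ℓ G ∸ ℓ F)
      (≤-trans (codim2-vertices (ℓ G ∸ ℓ F) size FG (sym (m+[n∸m]≡n (Span.F≤G FG)))) ∣V∣≤w)

    -- The rational exponent 3/2 replaces log 3, which turns the recursion in codimension 3 into a
    -- polynomial inequality.
    Bound₃ : ℕ → ℕ → Set
    Bound₃ w D = D ^ 2 ≤ (w ∸ 3) ^ 3

    bounded₃ : ∀ w → Bounded 3 w (Bound₃ w)
    bounded₃ = <-rec (λ w → Bounded 3 w (Bound₃ w)) go
      where
      square≤cube : ∀ x → x ^ 2 ≤ x ^ 3
      square≤cube zero      = z≤n
      square≤cube x@(suc _) = ^-monoʳ-≤ x (n≤1+n 2)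
      close : ∀ w {D} → Recursion 3 ⌊ suc w /2⌋ (_≤ w ∸ 2) (Bound₃ ⌊ suc w /2⌋) D →
              Bound₃ (suc w) D
      -- `w ∸ 2` is `suc w ∸ 3` by computation, so the codimension 2 bound is already in terms of
      -- the new base.
      close w (A , A≤ , inj₁ D≤A) = ≤-trans (^-monoˡ-≤ 2 (≤-trans D≤A A≤)) (square≤cube (w ∸ 2))
      close w (A , A≤ , inj₂ (3≤h , B , B≤ , D≤)) =
        square≤cube-step {A} {B} {y = ⌊ suc w /2⌋ ∸ 3} (2[⌊w/2⌋∸k]+k≤w∸k (suc w) 3 3≤h) A≤ B≤ D≤
      go : ∀ w → (∀ {v} → v < w → Bounded 3 v (Bound₃ v)) → Bounded 3 w (Bound₃ w)
      go zero    rec = Bounded-empty 2 (Bound₃ 0)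
      go (suc w) rec size FG ∣V∣≤ = close w
        (halving 2 w (_≤ w ∸ 2) (Bound₃ ⌊ suc w /2⌋) z≤n (bounded₂ w) (rec (⌊n/2⌋<n w)) size FG ∣V∣≤)

    Bound : ℕ → ℕ → ℕ → Set
    Bound k w D = LePowLog₂ D (w ∸ k) k

    -- Induction on the codimension and, within it, strong induction on w: each term of the
    -- recursion lowers the codimension or halves w.
    bounded : ∀ j w → Bounded (3 + j) w (Bound (3 + j) w)
    bounded zero    w size FG ∣V∣≤w = square≤cube⇒LePowLog₂-3 (bounded₃ w size FG ∣V∣≤w)
    bounded (suc j) = <-rec (λ w → Bounded (suc e) w (Bound (suc e) w)) go
      where
      e = 3 + j
      close : ∀ w {D} → Recursion (suc e) ⌊ suc w /2⌋ (Bound e w) (Bound (suc e) ⌊ suc w /2⌋) D →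
              Bound (suc e) (suc w) D
      close w (A , A≤ , inj₁ D≤A) = LePowLog₂-mono-≤ {x = w ∸ e} D≤A (n≤1+n e) A≤
      close w (A , A≤ , inj₂ (e<h , B , B≤ , D≤)) =
        LePowLog₂-step e (m≤m+n 3 j) (2[⌊w/2⌋∸k]+k≤w∸k (suc w) (suc e) e<h) A≤ B≤ D≤
      go : ∀ w → (∀ {v} → v < w → Bounded (suc e) v (Bound (suc e) v)) →
           Bounded (suc e) w (Bound (suc e) w)
      go zero    rec = Bounded-empty e (Bound (suc e) 0)
      go (suc w) rec size FG ∣V∣≤ = close w
        (halving e w (Bound e w) (Bound (suc e) ⌊ suc w /2⌋) (LePowLog₂-zero (w ∸ e) e)
          (bounded j w) (rec (⌊n/2⌋<n w)) size FG ∣V∣≤)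

  -- Dual distance to a fixed facet

  dualWalk? : ∀ t F G → Dec (DualWalk K t F G)
  dualWalk? zero F G = map′ (λ { (refl , F∈) → done F∈ }) (λ { (done F∈) → refl , F∈ })
    ((F ≟ˢ G) ×-dec (F ∈ˡ? facets))
    where open DecMembership _≟ˢ_ using () renaming (_∈?_ to _∈ˡ?_)
  dualWalk? (suc t) F G = map′
    (λ any → let _ , H∈ , F∈ , size , walk = L.find {P = Via} any in step (F∈ , H∈ , size) walk)
    (λ { (step (F∈ , H∈ , size) walk) → L.lose {P = Via} H∈ (F∈ , size , walk) })
    (any? (λ H → (F ∈ˡ? facets) ×-dec (∣ F ∩ H ∣ ≟ d ∸ 1) ×-dec dualWalk? t H G) facets)
    where
    open DecMembership _≟ˢ_ using () renaming (_∈?_ to _∈ˡ?_)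
    Via : Subset n → Set
    Via H = F L.∈ facets × ∣ F ∩ H ∣ ≡ d ∸ 1 × DualWalk K t H G

  Star⇒DualWalk : ∀ {σ F G} → F L.∈ facets → Star (StarAdj σ) F G → ∃[ t ] DualWalk K t F G
  Star⇒DualWalk F∈ ε = 0 , done F∈
  Star⇒DualWalk F∈ ((adj , _) ◅ path) with Star⇒DualWalk (proj₁ (proj₂ adj)) path
  ... | t , walk = suc t , step adj walk

  module Distance
    (G : Subset n)
    (reach : ∀ {F} → F L.∈ facets → ∃[ t ] DualWalk K t F G)
    where
    open DecMembership (_≟ˢ_ {n}) using () renaming (_∈?_ to _∈ˡ?_)

    -- Walks of a given length are decidable, so `least` can search below the length of the walk
    -- that `reach` provides.
    shortest : ∀ {F} → F L.∈ facets →
               ∃[ t ] (DualWalk K t F G × (∀ s → DualWalk K s F G → t ≤ s))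
    shortest {F} F∈ = least (λ t → dualWalk? t F G) (proj₁ (reach F∈)) (proj₂ (reach F∈))

    -- Junk value 0 outside the facets.
    distance : Subset n → ℕ
    distance F with F ∈ˡ? facets
    ... | yes F∈ = proj₁ (shortest F∈)
    ... | no  _  = 0

    distance-walk : ∀ {F} → F L.∈ facets → DualWalk K (distance F) F G
    distance-walk {F} F∈ with F ∈ˡ? facets
    ... | yes F∈′ = proj₁ (proj₂ (shortest F∈′))
    ... | no  F∉  = contradiction F∈ F∉

    distance-min : ∀ {F s} → DualWalk K s F G → distance F ≤ s
    distance-min {F} {s} walk with F ∈ˡ? facets
    ... | yes F∈ = proj₂ (proj₂ (shortest F∈)) s walk
    ... | no  _  = z≤n

    distance-lipschitz : ∀ {F H} → DualAdj K F H → distance F ≤ suc (distance H)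
    distance-lipschitz adj = distance-min (step adj (distance-walk (proj₁ (proj₂ adj))))

theorem5p3 : ∀ (d n : ℕ) → 4 ≤ d → d < n → (K : PureComplex d n) →
    Normal K → PseudomanifoldWithoutBoundary K →
    DualDiamLePowLog K (n ∸ d) d
theorem5p3 d@(suc (suc (suc j))) n (s≤s (s≤s (s≤s _))) _ K normal _ F G F∈ G∈ =
  -- The star of the empty face, of codimension d, contains every facet. The interval runs from G,
  -- at distance 0, up to F and uses at most n vertices.
  distance F , distance-walk F∈ ,
  subst (λ D → LePowLog₂ (distance F ∸ D) (n ∸ d) d) distance-G≡0
    (bounded j n size (span G∈ F∈ ⊥⊆ ⊥⊆ (≤-trans (≤-reflexive distance-G≡0) z≤n))
      (∣p∣≤n (vertices ⊥ (distance G) (distance F))))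
  where
  size : ∣ ⊥ {n} ∣ + d ≡ d
  size = cong (_+ d) (∣⊥∣≡0 n)
  open Distance K G (λ H∈ → Star⇒DualWalk K H∈ (star-connected K normal d size H∈ G∈ ⊥⊆ ⊥⊆))
  open Layers K distance distance-lipschitz (star-connected K normal)
  distance-G≡0 : distance G ≡ 0
  distance-G≡0 = n≤0⇒n≡0 (distance-min (done G∈))
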